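{- For every map $M$, $V\cap F\subseteq Z$.
   Context: A map is a triple $M=(C_M,v_M,f_M)$ where $C_M$ is a finite cubic graph (multiple edges allowed) and $v_M,f_M$ are disjoint perfect matchings whose union is a disjoint union of 4-cycles, the squares of $M$ (set $SQ(M)$). $a_M=E(C_M)\setminus(v_M\cup f_M)$; $z_M$ is the perfect matching on $V(C_M)$ formed by the diagonals of the squares; $Q_M=C_M\cup z_M$. For a map $X$, $G_X$ has as vertices the cycles of $v_X\cup a_X$, as edges the squares of $X$, each square joining the cycles containing its two $v_X$-edges. The dual is $D=(C_M,f_M,v_M)$, the phial is $P=(Q_M\setminus v_M,z_M,f_M)$, and edge sets of $G_M,G_D,G_P$ are identified with $SQ(M)$. $V,F,Z$ are the coboundary (edge-cut) spaces over $GF(2)$ of $G_M,G_D,G_P$, viewed as sets of subsets of $SQ(M)$. -}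

module Defs where

open import Data.Bool.Base using (Bool; true; false; not; _∨_; T)
open import Data.Bool.Properties using (T-irrelevant; T-∨)
open import Data.Empty using (⊥-elim)
open import Data.Fin.Base using (Fin; suc; punchIn; punchOut)
open import Data.Fin.Patterns using (0F; 1F; 2F; 3F)
open import Data.Fin.Properties
  using (+↔⊎; *↔×; punchIn-punchOut; punchOut-punchIn; punchOut-cong; punchInᵢ≢i)
import Data.Fin.Subset as Subset
open import Data.Fin.Subset using (Subset)
open import Data.Nat.Base using (ℕ; zero; suc)
open import Data.Product.Base using (Σ; Σ-syntax; ∃; ∃-syntax; _×_; _,_; proj₁; proj₂)
open import Data.Sum.Base as Sum using (_⊎_; inj₁; inj₂; [_,_]′)
open import Data.Sum.Function.Propositional using (_⊎-↔_)
open import Data.Unit.Base using (tt)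
open import Function.Base using (_∘_)
open import Function.Bundles using (_↔_; _⇔_; Func; Inverse; Equivalence; mk↔ₛ′)
open import Function.Construct.Composition using (_↔-∘_)
open import Function.Construct.Symmetry using (↔-sym)
open import Level using (0ℓ)
open import Relation.Binary.Bundles using (Setoid)
open import Relation.Binary.Construct.Closure.ReflexiveTransitive using (Star)
open import Relation.Binary.PropositionalEquality
  using (_≡_; _≢_; refl; sym; trans; cong; subst; setoid)
open import Relation.Nullary.Negation using (¬_)
open import Relation.Unary using (Pred)

-- Loops and parallel edges are allowed; the two ends of an edge are
-- indexed in an arbitrary order.
record Graph : Set₁ where
  field
    order       : ℕ
    Edge        : Set
    size        : ℕ
    enumeration : Edge ↔ Fin size
    end         : Edge → Fin 2 → Fin order

  Vertex : Set
  Vertex = Fin order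

  EdgeSet : Set
  EdgeSet = Edge → Bool

  infix 4 _∈_ _⊆_
  infixr 6 _∪_

  _∈_ : Edge → EdgeSet → Set
  e ∈ A = T (A e)

  _⊆_ : EdgeSet → EdgeSet → Set
  A ⊆ B = ∀ e → e ∈ A → e ∈ B

  all : EdgeSet
  all _ = true

  ∁ : EdgeSet → EdgeSet
  ∁ A e = not (A e)

  _∪_ : EdgeSet → EdgeSet → EdgeSet
  (A ∪ B) e = A e ∨ B e

  Disjoint : EdgeSet → EdgeSet → Set
  Disjoint A B = ∀ e → e ∈ A → ¬ (e ∈ B)

  Joins : Edge → Vertex → Vertex → Set
  Joins e x y = (end e 0F ≡ x × end e 1F ≡ y) ⊎ (end e 0F ≡ y × end e 1F ≡ x)

  -- Counting half-edges makes a loop contribute 2 to the degree.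
  HalfEdge : EdgeSet → Vertex → Set
  HalfEdge A x = Σ[ e ∈ Edge ] Σ[ i ∈ Fin 2 ] (e ∈ A × end e i ≡ x)

  HasDegree : EdgeSet → Vertex → ℕ → Set
  HasDegree A x d = HalfEdge A x ↔ Fin d

  Cubic : Set
  Cubic = ∀ x → HasDegree all x 3

  PerfectMatching : EdgeSet → Set
  PerfectMatching A = ∀ x → HasDegree A x 1

  Adjacent : EdgeSet → Edge → Edge → Set
  Adjacent A e e′ = e ∈ A × e′ ∈ A × ∃[ i ] ∃[ j ] end e i ≡ end e′ j

  Connected : EdgeSet → Set
  Connected A = ∀ e e′ → e ∈ A → e′ ∈ A → Star (Adjacent A) e e′

  -- A cycle is a nonempty connected subgraph in which every vertex has
  -- degree 2, given by its edges (so vertices off the cycle have degree 0).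
  -- Two parallel edges form a cycle of length 2.
  record IsCycle (A : EdgeSet) : Set where
    field
      nonempty   : ∃[ e ] e ∈ A
      two-valent : ∀ x → HasDegree A x 0 ⊎ HasDegree A x 2
      connected  : Connected A

  record CycleOf (A : EdgeSet) : Set where
    field
      edges   : EdgeSet
      within  : edges ⊆ A
      isCycle : IsCycle edges

  cycles : EdgeSet → Setoid 0ℓ 0ℓ
  cycles A = record
    { Carrier       = CycleOf A
    ; _≈_           = λ c d → ∀ e → edges c e ≡ edges d e
    ; isEquivalence = record
      { refl  = λ _ → refl
      ; sym   = λ p e → sym (p e)
      ; trans = λ p q e → trans (p e) (q e)
      }
    }
    where open CycleOf

next : Fin 4 → Fin 4
next 0F = 1F
next 1F = 2F
next 2F = 3F
next 3F = 0F

-- The edge set A is a disjoint union of the 4-cycles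
--   corner s 0F, side s 0F, corner s 1F, side s 1F, …, side s 3F, corner s 0F.
-- Choosing where each 4-cycle starts and its direction is only a labelling;
-- nothing is assumed about which sides belong to which matching.
-- Since all corners are distinct, so are all sides.
record FourCycles (G : Graph) (A : Graph.EdgeSet G) : Set where
  open Graph G
  field
    count     : ℕ
    corner    : Fin count → Fin 4 → Vertex
    side      : Fin count → Fin 4 → Edge
    joins     : ∀ s i → Joins (side s i) (corner s i) (corner s (next i))
    disjoint  : ∀ {s t i j} → corner s i ≡ corner t j → s ≡ t × i ≡ j
    side∈     : ∀ s i → side s i ∈ A
    exhausted : ∀ e → e ∈ A → ∃[ s ] ∃[ i ] side s i ≡ e

record Map : Set₁ where
  field
    C          : Graph
  open Graph C public
  field
    cubic      : Cubic
    v f        : EdgeSet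
    v-matching : PerfectMatching v
    f-matching : PerfectMatching f
    v-f        : Disjoint v f
    squares    : FourCycles C (v ∪ f)

  open FourCycles squares public

  Square : Set
  Square = Fin count

  a : EdgeSet
  a = ∁ (v ∪ f)

dual : Map → Map
dual M = record
  { C          = C
  ; cubic      = cubic
  ; v          = f
  ; f          = v
  ; v-matching = f-matching
  ; f-matching = v-matching
  ; v-f        = λ e p q → v-f e q p
  ; squares    = record
    { count     = count
    ; corner    = corner
    ; side      = side
    ; joins     = joins
    ; disjoint  = disjoint
    ; side∈     = λ s i → swap (v (side s i)) _ (side∈ s i)
    ; exhausted = λ e p → exhausted e (swap (f e) _ p)
    }
  }
  where
  open Map M
  swap : ∀ b c → T (b ∨ c) → T (c ∨ b)
  swap true  true  _ = tt
  swap true  false _ = tt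
  swap false true  _ = tt

-- The diagonals of a square join opposite corners: diagonal k has ends
-- opposite k 0F and opposite k 1F.
opposite : Fin 2 → Fin 2 → Fin 4
opposite 0F 0F = 0F
opposite 0F 1F = 2F
opposite 1F 0F = 1F
opposite 1F 1F = 3F

subset-finite : ∀ {n} (p : Fin n → Bool) → ∃[ m ] (Σ[ i ∈ Fin n ] T (p i)) ↔ Fin m
subset-finite {zero}  p = 0 , mk↔ₛ′ (λ ()) (λ ()) (λ ()) (λ ())
subset-finite {suc n} p with p 0F in eq | subset-finite (p ∘ suc)
... | true  | m , r = suc m , mk↔ₛ′ to from to-from from-to
  where
  module R = Inverse r
  to : (Σ[ i ∈ Fin (suc n) ] T (p i)) → Fin (suc m)
  to (0F , _)    = 0F
  to (suc i , t) = suc (R.to (i , t))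
  from : Fin (suc m) → Σ[ i ∈ Fin (suc n) ] T (p i)
  from 0F      = 0F , subst T (sym eq) tt
  from (suc j) = suc (proj₁ (R.from j)) , proj₂ (R.from j)
  to-from : ∀ j → to (from j) ≡ j
  to-from 0F      = refl
  to-from (suc j) = cong suc (R.strictlyInverseˡ j)
  from-to : ∀ x → from (to x) ≡ x
  from-to (0F , t)    = cong (0F ,_) (T-irrelevant _ _)
  from-to (suc i , t) = cong (λ (i , t) → suc i , t) (R.strictlyInverseʳ (i , t))
... | false | m , r = m , mk↔ₛ′ to from R.strictlyInverseˡ from-to
  where
  module R = Inverse r
  to : (Σ[ i ∈ Fin (suc n) ] T (p i)) → Fin m
  to (0F , t)    = ⊥-elim (subst T eq t)
  to (suc i , t) = R.to (i , t)
  from : Fin m → Σ[ i ∈ Fin (suc n) ] T (p i)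
  from j = suc (proj₁ (R.from j)) , proj₂ (R.from j)
  from-to : ∀ x → from (to x) ≡ x
  from-to (0F , t)    = ⊥-elim (subst T eq t)
  from-to (suc i , t) = cong (λ (i , t) → suc i , t) (R.strictlyInverseʳ (i , t))

infixl 6 _∖_

_∖_ : (G : Graph) → Graph.EdgeSet G → Graph
G ∖ A = record
  { order       = order
  ; Edge        = Σ[ e ∈ Edge ] e ∈ ∁ A
  ; size        = proj₁ fin
  ; enumeration = proj₂ fin ↔-∘ mk↔ₛ′ to from to-from from-to
  ; end         = end ∘ proj₁
  }
  where
  open Graph G
  module N = Inverse enumeration
  fin = subset-finite (∁ A ∘ N.from)
  to : (Σ[ e ∈ Edge ] e ∈ ∁ A) → Σ[ i ∈ Fin size ] T (∁ A (N.from i))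
  to (e , t) = N.to e , subst (_∈ ∁ A) (sym (N.strictlyInverseʳ e)) t
  from : (Σ[ i ∈ Fin size ] T (∁ A (N.from i))) → Σ[ e ∈ Edge ] e ∈ ∁ A
  from (i , t) = N.from i , t
  pair : ∀ {X : Set} {p : X → Bool} {x y : Σ[ x ∈ X ] T (p x)} → proj₁ x ≡ proj₁ y → x ≡ y
  pair {x = x , _} refl = cong (x ,_) (T-irrelevant _ _)
  to-from : ∀ x → to (from x) ≡ x
  to-from (i , t) = pair (N.strictlyInverseˡ i)
  from-to : ∀ x → from (to x) ≡ x
  from-to (e , t) = pair (N.strictlyInverseʳ e)

module _ (M : Map) where
  open Map M

  Q : Graph
  Q = record
    { order       = order
    ; Edge        = Edge ⊎ (Square × Fin 2)
    ; size        = _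
    ; enumeration = ↔-sym +↔⊎ ↔-∘ (enumeration ⊎-↔ ↔-sym *↔×)
    ; end         = [ end , (λ (s , k) i → corner s (opposite k i)) ]′
    }

  fromC : EdgeSet → Graph.EdgeSet Q
  fromC A = [ A , (λ _ → false) ]′

  z : Graph.EdgeSet Q
  z = [ (λ _ → false) , (λ _ → true) ]′

module Phial (M : Map) where
  open Map M

  P : Graph
  P = Q M ∖ fromC M v

  module P = Graph P

  zP fP : P.EdgeSet
  zP = z M ∘ proj₁
  fP = fromC M f ∘ proj₁

  ∈∁ : ∀ {b} → ¬ T b → T (not b)
  ∈∁ {false} _ = tt
  ∈∁ {true}  n = n tt

  ∈∁⁻ : ∀ {b} → T (not b) → ¬ T b
  ∈∁⁻ {false} _ ()

  f⇒∁v : ∀ {e} → e ∈ f → e ∈ ∁ v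
  f⇒∁v p = ∈∁ (λ q → v-f _ q p)

  1-unique : ∀ {A : Set} → A ↔ Fin 1 → (x y : A) → x ≡ y
  1-unique r x y = trans (sym (strictlyInverseʳ x))
    (trans (cong from (fin1 (to x) (to y))) (strictlyInverseʳ y))
    where
    open Inverse r
    fin1 : (i j : Fin 1) → i ≡ j
    fin1 0F 0F = refl

  unique : ∀ {A} → PerfectMatching A → ∀ {e e′ i j} →
           e ∈ A → e′ ∈ A → end e i ≡ end e′ j → e ≡ e′
  unique m {e} {e′} {i} {j} p p′ q =
    cong proj₁ (1-unique (m (end e′ j)) (e , i , p , q) (e′ , j , p′ , refl))

  i≢next : ∀ i → i ≢ next i
  i≢next 0F ()
  i≢next 1F ()
  i≢next 2F ()
  i≢next 3F ()

  i≢next² : ∀ i → i ≢ next (next i)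
  i≢next² 0F ()
  i≢next² 1F ()
  i≢next² 2F ()
  i≢next² 3F ()

  source : ∀ {e x y} → Joins e x y → ∃[ i ] end e i ≡ x
  source (inj₁ (p , _)) = 0F , p
  source (inj₂ (_ , p)) = 1F , p

  flip : ∀ {e x y} → Joins e x y → Joins e y x
  flip = Sum.swap

  side≢next : ∀ s i → side s i ≢ side s (next i)
  side≢next s i eq with subst (λ e → Joins e _ _) eq (joins s i) | joins s (next i)
  ... | inj₁ (p , _) | inj₁ (q , _) = i≢next i (proj₂ (disjoint (trans (sym p) q)))
  ... | inj₁ (p , _) | inj₂ (q , _) = i≢next² i (proj₂ (disjoint (trans (sym p) q)))
  ... | inj₂ (_ , p) | inj₁ (_ , q) = i≢next² i (proj₂ (disjoint (trans (sym p) q)))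
  ... | inj₂ (_ , p) | inj₂ (_ , q) = i≢next i (proj₂ (disjoint (trans (sym p) q)))

  not-both : ∀ {A} → PerfectMatching A → ∀ s i → side s i ∈ A → ¬ (side s (next i) ∈ A)
  not-both m s i p q =
    let _ , x = source (flip (joins s i))
        _ , y = source (joins s (next i))
    in side≢next s i (unique m p q (trans x (sym y)))

  v⊎f : ∀ s i → side s i ∈ v ⊎ side s i ∈ f
  v⊎f s i = Equivalence.to (T-∨ {v (side s i)}) (side∈ s i)

  v-next : ∀ s i → side s i ∈ v → side s (next i) ∈ f
  v-next s i p with v⊎f s (next i)
  ... | inj₁ q = ⊥-elim (not-both v-matching s i p q)
  ... | inj₂ q = q

  f-next : ∀ s i → side s i ∈ f → side s (next i) ∈ v
  f-next s i p with v⊎f s (next i)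
  ... | inj₁ q = q
  ... | inj₂ q = ⊥-elim (not-both f-matching s i p q)

  data Alternation (s : Square) : Set where
    f-odd  : side s 1F ∈ f → side s 3F ∈ f → side s 0F ∈ v → side s 2F ∈ v → Alternation s
    f-even : side s 0F ∈ f → side s 2F ∈ f → side s 1F ∈ v → side s 3F ∈ v → Alternation s

  alternation : ∀ s → Alternation s
  alternation s with v⊎f s 0F
  ... | inj₁ v0 = let f1 = v-next s 0F v0; v2 = f-next s 1F f1; f3 = v-next s 2F v2
                  in f-odd f1 f3 v0 v2
  ... | inj₂ f0 = let v1 = f-next s 0F f0; f2 = v-next s 1F v1; v3 = f-next s 2F f2
                  in f-even f0 f2 v1 v3

  corner-of : ∀ x → ∃[ s ] ∃[ i ] corner s i ≡ x
  corner-of x with Inverse.from (v-matching x) 0F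
  ... | e , i , p , q with exhausted e (Equivalence.from (T-∨ {v e}) (inj₁ p))
  ... | s , k , refl with joins s k | i
  ... | inj₁ (r , _) | 0F = s , k , trans (sym r) q
  ... | inj₁ (_ , r) | 1F = s , next k , trans (sym r) q
  ... | inj₂ (r , _) | 0F = s , next k , trans (sym r) q
  ... | inj₂ (_ , r) | 1F = s , k , trans (sym r) q

  Diagonal : Vertex → Set
  Diagonal x = Σ[ s ∈ Square ] Σ[ k ∈ Fin 2 ] Σ[ i ∈ Fin 2 ] corner s (opposite k i) ≡ x

  opposite⁻¹ : Fin 4 → Fin 2 × Fin 2
  opposite⁻¹ 0F = 0F , 0F
  opposite⁻¹ 1F = 1F , 0F
  opposite⁻¹ 2F = 0F , 1F
  opposite⁻¹ 3F = 1F , 1F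

  opposite⁻ : ∀ j → ∃[ k ] ∃[ i ] opposite k i ≡ j
  opposite⁻ 0F = 0F , 0F , refl
  opposite⁻ 1F = 1F , 0F , refl
  opposite⁻ 2F = 0F , 1F , refl
  opposite⁻ 3F = 1F , 1F , refl

  opposite-injective : ∀ k i k′ i′ → opposite k i ≡ opposite k′ i′ → (k , i) ≡ (k′ , i′)
  opposite-injective k i k′ i′ eq =
    trans (sym (inv k i)) (trans (cong opposite⁻¹ eq) (inv k′ i′))
    where
    inv : ∀ k i → opposite⁻¹ (opposite k i) ≡ (k , i)
    inv 0F 0F = refl
    inv 0F 1F = refl
    inv 1F 0F = refl
    inv 1F 1F = refl

  diagonal-at : ∀ x → Diagonal x ↔ Fin 1
  diagonal-at x with corner-of x
  ... | s , j , refl with opposite⁻ j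
  ... | k , i , refl =
    mk↔ₛ′ (λ _ → 0F) (λ _ → s , k , i , refl) 0F-only only
    where
    0F-only : (i : Fin 1) → 0F ≡ i
    0F-only 0F = refl
    only : ∀ d → (s , k , i , refl) ≡ d
    only (s′ , k′ , i′ , eq) with disjoint eq
    ... | refl , q with opposite-injective k′ i′ k i q
    only (s′ , k′ , i′ , refl) | refl , q | refl = refl

  remove-one : ∀ {X : Set} (p : X → Bool) {n} → X ↔ Fin (suc n) →
               (Σ[ x ∈ X ] T (p x)) ↔ Fin 1 → (Σ[ x ∈ X ] T (not (p x))) ↔ Fin n
  remove-one {X} p {n} r one = mk↔ₛ′ to from to-from from-to
    where
    module R = Inverse r
    x₀ : Σ[ x ∈ X ] T (p x)
    x₀ = Inverse.from one 0F
    i₀ : Fin (suc n)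
    i₀ = R.to (proj₁ x₀)
    apart : ∀ x → T (not (p x)) → i₀ ≢ R.to x
    apart x t eq = ∈∁⁻ t (subst (T ∘ p) x₀≡x (proj₂ x₀))
      where
      x₀≡x : proj₁ x₀ ≡ x
      x₀≡x = trans (sym (R.strictlyInverseʳ _)) (trans (cong R.from eq) (R.strictlyInverseʳ x))
    to : (Σ[ x ∈ X ] T (not (p x))) → Fin n
    to (x , t) = punchOut (apart x t)
    from : Fin n → Σ[ x ∈ X ] T (not (p x))
    from j = R.from (punchIn i₀ j) , ∈∁ λ t → punchInᵢ≢i i₀ j
      (trans (sym (R.strictlyInverseˡ _)) (cong (R.to ∘ proj₁) (1-unique one (_ , t) x₀)))
    to-from : ∀ j → to (from j) ≡ j
    to-from j = trans (punchOut-cong i₀ (R.strictlyInverseˡ _)) (punchOut-punchIn i₀ {j})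
    pair : ∀ {x y : Σ[ x ∈ X ] T (not (p x))} → proj₁ x ≡ proj₁ y → x ≡ y
    pair {x , _} refl = cong (x ,_) (T-irrelevant _ _)
    from-to : ∀ y → from (to y) ≡ y
    from-to (x , t) =
      pair (trans (cong R.from (punchIn-punchOut (apart x t))) (R.strictlyInverseʳ x))

  restrict : ∀ A x → (Σ[ h ∈ HalfEdge all x ] T (A (proj₁ h))) ↔ HalfEdge A x
  restrict A x = mk↔ₛ′ (λ { ((e , i , _ , q) , t) → e , i , t , q })
                       (λ { (e , i , t , q) → (e , i , tt , q) , t })
                       (λ _ → refl) (λ _ → refl)

  ∁v-degree : ∀ x → HasDegree (∁ v) x 2
  ∁v-degree x = remove-one (v ∘ proj₁) (cubic x) (v-matching x ↔-∘ restrict v x)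
                ↔-∘ ↔-sym (restrict (∁ v) x)

  P-cubic : P.Cubic
  P-cubic x = ↔-sym +↔⊎ ↔-∘ ((∁v-degree x ⊎-↔ diagonal-at x) ↔-∘ mk↔ₛ′
    (λ { ((inj₁ e , t) , i , _ , q) → inj₁ (e , i , t , q)
       ; ((inj₂ (s , k) , _) , i , _ , q) → inj₂ (s , k , i , q) })
    (λ { (inj₁ (e , i , t , q)) → (inj₁ e , t) , i , tt , q
       ; (inj₂ (s , k , i , q)) → (inj₂ (s , k) , tt) , i , tt , q })
    (λ { (inj₁ _) → refl ; (inj₂ _) → refl })
    (λ { ((inj₁ _ , _) , _) → refl ; ((inj₂ _ , _) , _) → refl }))

  zP-matching : P.PerfectMatching zP
  zP-matching x = diagonal-at x ↔-∘ mk↔ₛ′ to from (λ _ → refl) from-to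
    where
    to : P.HalfEdge zP x → Diagonal x
    to ((inj₁ _ , _) , _ , () , _)
    to ((inj₂ (s , k) , _) , i , _ , q) = s , k , i , q
    from : Diagonal x → P.HalfEdge zP x
    from (s , k , i , q) = (inj₂ (s , k) , tt) , i , tt , q
    from-to : ∀ h → from (to h) ≡ h
    from-to ((inj₁ _ , _) , _ , () , _)
    from-to ((inj₂ _ , _) , _) = refl

  fP-matching : P.PerfectMatching fP
  fP-matching x = f-matching x ↔-∘ mk↔ₛ′ to from (λ _ → refl) from-to
    where
    to : P.HalfEdge fP x → HalfEdge f x
    to ((inj₁ e , _) , i , p , q) = e , i , p , q
    to ((inj₂ _ , _) , _ , () , _)
    from : HalfEdge f x → P.HalfEdge fP x
    from (e , i , p , q) = (inj₁ e , f⇒∁v p) , i , p , q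
    from-to : ∀ h → from (to h) ≡ h
    from-to ((inj₁ e , t) , i , p , q) =
      cong (λ t → (inj₁ e , t) , i , p , q) (T-irrelevant _ t)
    from-to ((inj₂ _ , _) , _ , () , _)

  z-f : P.Disjoint zP fP
  z-f (inj₁ _ , _) () _
  z-f (inj₂ _ , _) _ ()

  -- Each square of the phial has the corners of a square of M, visited in
  -- the order in which diagonals and f-edges alternate.
  perm : ∀ {s} → Alternation s → Fin 4 → Fin 4
  perm _              0F = 0F
  perm _              1F = 2F
  perm (f-odd  _ _ _ _) 2F = 1F
  perm (f-odd  _ _ _ _) 3F = 3F
  perm (f-even _ _ _ _) 2F = 3F
  perm (f-even _ _ _ _) 3F = 1F

  perm-injective : ∀ {s} (α : Alternation s) {i j} → perm α i ≡ perm α j → i ≡ j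
  perm-injective α@(f-odd _ _ _ _)  {i} {j} eq = trans (sym (inv i)) (trans (cong (perm α) eq) (inv j))
    where
    inv : ∀ i → perm α (perm α i) ≡ i
    inv 0F = refl
    inv 1F = refl
    inv 2F = refl
    inv 3F = refl
  perm-injective α@(f-even _ _ _ _) {i} {j} eq = trans (sym (inv i)) (trans (cong (perm α ∘ perm α) eq) (inv j))
    where
    inv : ∀ i → perm α (perm α (perm α i)) ≡ i
    inv 0F = refl
    inv 1F = refl
    inv 2F = refl
    inv 3F = refl

  sideP : ∀ s → Alternation s → Fin 4 → P.Edge
  sideP s _                    0F = inj₂ (s , 0F) , tt
  sideP s _                    2F = inj₂ (s , 1F) , tt
  sideP s (f-odd  f1 f3 _ _) 1F = inj₁ (side s 1F) , f⇒∁v f1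
  sideP s (f-odd  f1 f3 _ _) 3F = inj₁ (side s 3F) , f⇒∁v f3
  sideP s (f-even f0 f2 _ _) 1F = inj₁ (side s 2F) , f⇒∁v f2
  sideP s (f-even f0 f2 _ _) 3F = inj₁ (side s 0F) , f⇒∁v f0

  joinsP : ∀ s α i → P.Joins (sideP s α i) (corner s (perm α i)) (corner s (perm α (next i)))
  joinsP s (f-odd  _ _ _ _) 0F = inj₁ (refl , refl)
  joinsP s (f-odd  _ _ _ _) 1F = flip {side s 1F} (joins s 1F)
  joinsP s (f-odd  _ _ _ _) 2F = inj₁ (refl , refl)
  joinsP s (f-odd  _ _ _ _) 3F = joins s 3F
  joinsP s (f-even _ _ _ _) 0F = inj₁ (refl , refl)
  joinsP s (f-even _ _ _ _) 1F = joins s 2F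
  joinsP s (f-even _ _ _ _) 2F = inj₂ (refl , refl)
  joinsP s (f-even _ _ _ _) 3F = flip {side s 0F} (joins s 0F)

  side∈P : ∀ s α i → sideP s α i P.∈ (zP P.∪ fP)
  side∈P s (f-odd  f1 f3 _ _) 0F = tt
  side∈P s (f-odd  f1 f3 _ _) 1F = f1
  side∈P s (f-odd  f1 f3 _ _) 2F = tt
  side∈P s (f-odd  f1 f3 _ _) 3F = f3
  side∈P s (f-even f0 f2 _ _) 0F = tt
  side∈P s (f-even f0 f2 _ _) 1F = f2
  side∈P s (f-even f0 f2 _ _) 2F = tt
  side∈P s (f-even f0 f2 _ _) 3F = f0

  reach-f : ∀ s α i (t : side s i ∈ ∁ v) → side s i ∈ f →
            ∃[ j ] sideP s α j ≡ (inj₁ (side s i) , t)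
  reach-f s (f-odd  _ _ v0 _) 0F t p = ⊥-elim (∈∁⁻ t v0)
  reach-f s (f-odd  _ _ _ _ ) 1F t p = 1F , cong (inj₁ _ ,_) (T-irrelevant _ _)
  reach-f s (f-odd  _ _ _ v2) 2F t p = ⊥-elim (∈∁⁻ t v2)
  reach-f s (f-odd  _ _ _ _ ) 3F t p = 3F , cong (inj₁ _ ,_) (T-irrelevant _ _)
  reach-f s (f-even _ _ _ _ ) 0F t p = 3F , cong (inj₁ _ ,_) (T-irrelevant _ _)
  reach-f s (f-even _ _ v1 _) 1F t p = ⊥-elim (∈∁⁻ t v1)
  reach-f s (f-even _ _ _ _ ) 2F t p = 1F , cong (inj₁ _ ,_) (T-irrelevant _ _)
  reach-f s (f-even _ _ _ v3) 3F t p = ⊥-elim (∈∁⁻ t v3)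

  exhaustedP : ∀ e → e P.∈ (zP P.∪ fP) → ∃[ s ] ∃[ i ] sideP s (alternation s) i ≡ e
  exhaustedP (inj₂ (s , 0F) , _) _ = s , 0F , refl
  exhaustedP (inj₂ (s , 1F) , _) _ = s , 2F , refl
  exhaustedP (inj₁ e , t) p with exhausted e (Equivalence.from (T-∨ {v e}) (inj₂ p))
  ... | s , i , refl = s , reach-f s (alternation s) i t p

  disjointP : ∀ {s t i j} → corner s (perm (alternation s) i) ≡ corner t (perm (alternation t) j) →
              s ≡ t × i ≡ j
  disjointP {s} eq with disjoint eq
  ... | refl , q = refl , perm-injective (alternation s) q

phial : Map → Map
phial M = record
  { C          = Q M ∖ fromC M v
  ; cubic      = P-cubic
  ; v          = zP
  ; f          = fP
  ; v-matching = zP-matching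
  ; f-matching = fP-matching
  ; v-f        = z-f
  ; squares    = record
    { count     = count
    ; corner    = λ s → corner s ∘ perm (alternation s)
    ; side      = λ s → sideP s (alternation s)
    ; joins     = λ s → joinsP s (alternation s)
    ; disjoint  = disjointP
    ; side∈     = λ s → side∈P s (alternation s)
    ; exhausted = exhaustedP
    }
  }
  where
  open Map M
  open Phial M

-- Graphs with m edges whose vertices form a setoid; endpoints are given by
-- the symmetric relation Joins.
record SetoidGraph (m : ℕ) : Set₁ where
  field
    vertices : Setoid 0ℓ 0ℓ
  Vertex : Set
  Vertex = Setoid.Carrier vertices
  field
    Joins : Fin m → Vertex → Vertex → Set

-- The image of the coboundary map over GF(2), i.e. the edge cuts δ(S) for S
-- a set of vertices: e lies in δ(S) exactly when it has one end in S and the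
-- other outside S.
Coboundary : ∀ {m} → SetoidGraph m → Pred (Subset m) 0ℓ
Coboundary G X =
  Σ[ S ∈ Func vertices (setoid Bool) ]
    ∀ e → (e Subset.∈ X) ⇔
          (∃[ c ] ∃[ d ] Joins e c d × Func.to S c ≡ true × Func.to S d ≡ false)
  where open SetoidGraph G

G : (X : Map) → SetoidGraph (Map.count X)
G X = record
  { vertices = cycles (v ∪ a)
  ; Joins    = λ s c d → ∃[ i ] ∃[ j ] i ≢ j
                 × side s i ∈ v × side s i ∈ edges c
                 × side s j ∈ v × side s j ∈ edges d
  }
  where
  open Map X
  open CycleOf

-- The squares of M, dual M and phial M are indexed by the same Fin (count M),
-- squares with the same index having the same corners.
V F Z : (M : Map) → Pred (Subset (Map.count M)) 0ℓ
V M = Coboundary (G M)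
F M = Coboundary (G (dual M))
Z M = Coboundary (G (phial M))

{-# OPTIONS --safe #-}

-- A set U of squares is a cut of G_X exactly when some 2-colouring of the
-- vertices of C_X is constant along the edges of v_X ∪ a_X and changes between
-- the two v_X-edges of precisely the squares in U.  Given such colourings κ₁
-- for M and κ₂ for its dual, with the same U, their sum κ₁ + κ₂ is constant
-- along a_M and along the diagonals (each summand changes along the diagonals
-- of exactly the squares in U), and it changes along the v_M-edges of exactly
-- the squares in U; so it exhibits U as a cut for the phial.

module Submission where

open import Defs
open import Relation.Unary using (_∩_; _⊆_)

open import Data.Bool.Base using (Bool; true; false; not; _∧_; _∨_; _xor_; T)
open import Data.Bool.Properties
  using (T-irrelevant; T-∧; T-∨; T-≡; T?; xor-comm; xor-annihilates-not; ⇔→≡)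
open import Data.Empty using (⊥-elim)
open import Data.Fin.Base using (Fin; punchOut)
open import Data.Fin.Patterns using (0F; 1F; 2F; 3F)
open import Data.Fin.Properties using (any?; _≟_; inj⇒≟; injective⇒≤; punchOut-injective)
open import Data.Fin.Subset as Subset using (Subset)
open import Data.List.Base using (List; []; _∷_; map; allFin; cartesianProduct)
open import Data.List.Membership.Propositional renaming (_∈_ to _∈ₗ_) using ()
open import Data.List.Membership.Propositional.Properties
  using (∈-map⁺; ∈-allFin; ∈-cartesianProduct⁺)
open import Data.List.Relation.Unary.Any using (here; there)
open import Data.Nat.Base using (suc)
open import Data.Nat.Properties using (1+n≰n)
open import Data.Product.Base using (Σ-syntax; ∃-syntax; _×_; _,_; proj₁; proj₂)
open import Data.Sum.Base using (_⊎_; inj₁; inj₂)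
open import Data.Unit.Base using (tt)
open import Data.Vec.Base using (lookup)
open import Data.Vec.Properties using (lookup⇒[]=; []=⇒lookup)
open import Function.Base using (_∘_)
open import Function.Bundles using (_↔_; Func; Inverse; Injection; Equivalence; mk⇔; mk↔ₛ′)
open import Function.Construct.Composition using (_↔-∘_)
open import Function.Construct.Symmetry using (↔-sym)
open import Function.Definitions using (Injective)
open import Function.Properties.Inverse using (↔⇒↣)
open import Relation.Binary.Construct.Closure.ReflexiveTransitive
  using (Star; ε; _◅_; _◅◅_; reverse) renaming (map to mapStar)
open import Relation.Binary.Core using (Rel)
open import Relation.Binary.Definitions using (Decidable; DecidableEquality; Symmetric)
open import Relation.Binary.PropositionalEquality
  using (_≡_; _≢_; refl; sym; trans; cong; cong₂; subst; setoid)
open import Relation.Nullary using (yes; no; ¬_; contradiction)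
open import Relation.Nullary.Decidable using (⌊_⌋; toWitness; fromWitness; _×-dec_)
open import Level using (0ℓ)

-- Finite sets: pigeonhole and connected components.

injective⇒surjective : ∀ {n} {g : Fin n → Fin n} → Injective _≡_ _≡_ g → ∀ k → ∃[ i ] g i ≡ k
injective⇒surjective {suc n} {g} inj k with any? (λ i → g i ≟ k)
... | yes found = found
... | no missed = contradiction (injective⇒≤ avoid-injective) 1+n≰n
  where
  k≢ : ∀ i → k ≢ g i
  k≢ i eq = missed (i , sym eq)
  avoid : Fin (suc n) → Fin n
  avoid i = punchOut (k≢ i)
  avoid-injective : Injective _≡_ _≡_ avoid
  avoid-injective eq = inj (punchOut-injective (k≢ _) (k≢ _) eq)

module _ {X : Set} (_≟ₓ_ : DecidableEquality X) {R : Rel X 0ℓ} (R? : Decidable R)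
         (R-sym : Symmetric R) where

  -- Union-find along the list: a related pair `(u , w)` redirects whatever is labelled `l u` to
  -- `l w`, which is reached by walking back to `u`, over to `w` and on to `l w`. Once `ps` lists
  -- all pairs, `l` picks one element of each component of `R`, so lying in the same component is
  -- decided by comparing labels.
  representatives : (ps : List (X × X)) →
          Σ[ l ∈ (X → X) ] (∀ x → Star R x (l x)) ×
                           (∀ {x y} → (x , y) ∈ₗ ps → R x y → l x ≡ l y)
  representatives [] = (λ x → x) , (λ _ → ε) , λ ()
  representatives ((u , w) ∷ ps) with representatives ps | R? u w
  ... | l , reach , equal | no ¬r = l , reach , λ
    { (here refl) r → contradiction r ¬r
    ; (there p) r → equal p r }
  ... | l , reach , equal | yes r = (λ x → redirect (l x)) , reach′ , equal′
    where
    redirect : X → X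
    redirect y with y ≟ₓ l u
    ... | yes _ = l w
    ... | no  _ = y
    redirect-from : ∀ y → y ≡ l u → redirect y ≡ l w
    redirect-from y eq with y ≟ₓ l u
    ... | yes _ = refl
    ... | no  n = contradiction eq n
    redirect-to : ∀ y → y ≡ l w → redirect y ≡ l w
    redirect-to y eq with y ≟ₓ l u
    ... | yes _ = refl
    ... | no  _ = eq
    redirect-reach : ∀ y → Star R y (redirect y)
    redirect-reach y with y ≟ₓ l u
    ... | yes refl = reverse R-sym (reach u) ◅◅ r ◅ reach w
    ... | no  _    = ε
    reach′ : ∀ x → Star R x (redirect (l x))
    reach′ x = reach x ◅◅ redirect-reach (l x)
    equal′ : ∀ {x y} → (x , y) ∈ₗ ((u , w) ∷ ps) → R x y → redirect (l x) ≡ redirect (l y)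
    equal′ (here refl) _ = trans (redirect-from (l u) refl) (sym (redirect-to (l w) refl))
    equal′ (there p) q   = cong redirect (equal p q)

-- Cycles of a 2-regular edge set.

module _ (G : Graph) where
  open Graph G hiding (_⊆_)

  -- The hypotheses are local to `x` because a component of an edge set agrees with that set at the
  -- vertices it meets, but not globally.
  HalfEdge-cong : ∀ {B C x} → (∀ e i → end e i ≡ x → e ∈ B → e ∈ C) →
                  (∀ e i → end e i ≡ x → e ∈ C → e ∈ B) → HalfEdge B x ↔ HalfEdge C x
  HalfEdge-cong to from = mk↔ₛ′
    (λ (e , i , p , q) → e , i , to e i q p , q)
    (λ (e , i , p , q) → e , i , from e i q p , q)
    (λ (e , i , p , q) → cong (λ p → e , i , p , q) (T-irrelevant _ _))
    (λ (e , i , p , q) → cong (λ p → e , i , p , q) (T-irrelevant _ _))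

-- A vertex colouring that is constant along the edges of a 2-regular edge set
-- is the same thing as a colouring of its cycles, namely its components.
module TwoRegular (G : Graph) (A : Graph.EdgeSet G)
                  (degree : ∀ x → Graph.HasDegree G A x 2) where
  open Graph G hiding (_⊆_)
  open CycleOf
  open IsCycle
  private module N = Inverse enumeration

  Represents : Func (cycles A) (setoid Bool) → (Vertex → Bool) → Set
  Represents S κ = ∀ c {e} i → e ∈ edges c → Func.to S c ≡ κ (end e i)

  Adjacent-sym : ∀ {B} → Symmetric (Adjacent B)
  Adjacent-sym (p , q , i , j , eq) = q , p , j , i , sym eq

  Adjacent? : Decidable (Adjacent A)
  Adjacent? e e′ = T? (A e) ×-dec T? (A e′) ×-dec
                   any? (λ i → any? (λ j → end e i ≟ end e′ j))

  _≟ₑ_ : DecidableEquality Edge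
  _≟ₑ_ = inj⇒≟ (↔⇒↣ enumeration)

  edgeList : List Edge
  edgeList = map N.from (allFin size)

  ∈-edgeList : ∀ e → e ∈ₗ edgeList
  ∈-edgeList e = subst (_∈ₗ edgeList) (N.strictlyInverseʳ e) (∈-map⁺ N.from (∈-allFin (N.to e)))

  opaque
    components : Σ[ l ∈ (Edge → Edge) ] (∀ e → Star (Adjacent A) e (l e)) ×
                                        (∀ {e e′} → Adjacent A e e′ → l e ≡ l e′)
    components =
      let l , reach , equal = representatives _≟ₑ_ Adjacent? Adjacent-sym
                                         (cartesianProduct edgeList edgeList)
      in l , reach , equal (∈-cartesianProduct⁺ (∈-edgeList _) (∈-edgeList _))

  component : Edge → Edge
  component = proj₁ components

  component-reach : ∀ e → Star (Adjacent A) e (component e)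
  component-reach = proj₁ (proj₂ components)

  component-Adjacent : ∀ {e e′} → Adjacent A e e′ → component e ≡ component e′
  component-Adjacent = proj₂ (proj₂ components)

  opaque
    -- The cycle is the component of `e₀`, cut out of `A` by its label. All edges of `A` at a vertex
    -- are adjacent and share a label, so testing one of them shows whether the degree there is 2 or
    -- 0. Two edges of `B` are linked through their common label, and the walk stays in `B` because
    -- `B` is closed under adjacency.
    cycleThrough : ∀ e → e ∈ A → CycleOf A
    cycleThrough e₀ p₀ = record
      { edges   = B
      ; within  = λ _ → ∈A
      ; isCycle = record
        { nonempty   = e₀ , ∈B p₀ refl
        ; two-valent = two-valent′
        ; connected  = λ e e′ p p′ → lift p (component-reach e ◅◅
            subst (λ c → Star _ c e′) (trans (≡component p′) (sym (≡component p)))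
                  (reverse Adjacent-sym (component-reach e′)))
        }
      }
      where
      B : EdgeSet
      B e = A e ∧ ⌊ component e ≟ₑ component e₀ ⌋
      ∈A : ∀ {e} → e ∈ B → e ∈ A
      ∈A p = proj₁ (Equivalence.to T-∧ p)
      ≡component : ∀ {e} → e ∈ B → component e ≡ component e₀
      ≡component {e} p = toWitness (proj₂ (Equivalence.to (T-∧ {A e}) p))
      ∈B : ∀ {e} → e ∈ A → component e ≡ component e₀ → e ∈ B
      ∈B p eq = Equivalence.from T-∧ (p , fromWitness eq)
      Adjacent-∈B : ∀ {e e′} → e ∈ B → Adjacent A e e′ → e′ ∈ B
      Adjacent-∈B p r@(_ , q , _) = ∈B q (trans (sym (component-Adjacent r)) (≡component p))
      lift : ∀ {e e′} → e ∈ B → Star (Adjacent A) e e′ → Star (Adjacent B) e e′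
      lift p ε = ε
      lift p (r@(_ , _ , j) ◅ rs) = (p , Adjacent-∈B p r , j) ◅ lift (Adjacent-∈B p r) rs
      two-valent′ : ∀ x → HasDegree B x 0 ⊎ HasDegree B x 2
      two-valent′ x with Inverse.from (degree x) 0F
      ... | e , i , p , q with T? (B e)
      ...   | yes b = inj₂ (degree x ↔-∘ HalfEdge-cong G (λ _ _ _ → ∈A)
                        (λ e′ j q′ p′ → Adjacent-∈B b (p , p′ , i , j , trans q (sym q′))))
      ...   | no ¬b = inj₁ (mk↔ₛ′ (⊥-elim ∘ none) (λ ()) (λ ()) (⊥-elim ∘ none))
        where
        none : ¬ HalfEdge B x
        none (e′ , j , p′ , q′) = ¬b (Adjacent-∈B p′ (∈A p′ , p , j , i , trans q′ (sym q)))

    ∈-cycleThrough : ∀ {e} (p : e ∈ A) → e ∈ edges (cycleThrough e p)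
    ∈-cycleThrough p = proj₂ (nonempty (isCycle (cycleThrough _ p)))

  -- Both sets of half-edges at `x` have `n` elements, so their inclusion, read as a map on `Fin n`,
  -- is onto by pigeonhole. Injectivity goes through `forget`, which drops the membership proof, the
  -- only place where the two kinds of half-edge differ.
  full-degree : ∀ {B x n} → (∀ e → e ∈ B → e ∈ A) → HasDegree B x n → HasDegree A x n →
                ∀ e i → e ∈ A → end e i ≡ x → e ∈ B
  full-degree {B} {x} B⊆A dB dA e i p q =
    let k , eq = injective⇒surjective position-injective (DA.to (e , i , p , q))
        e′ , _ , p′ , _ = DB.from k
    in subst (_∈ B) (cong proj₁ (Injection.injective (↔⇒↣ dA) eq)) p′
    where
    module DA = Inverse dA
    module DB = Inverse dB
    forget : ∀ {C} → HalfEdge C x → Σ[ e ∈ Edge ] Σ[ i ∈ Fin 2 ] end e i ≡ x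
    forget (e , i , _ , q) = e , i , q
    forget-injective : ∀ {C} {h h′ : HalfEdge C x} → forget h ≡ forget h′ → h ≡ h′
    forget-injective {h = e , i , p , q} {_ , _ , p′ , _} refl =
      cong (λ p → e , i , p , q) (T-irrelevant p p′)
    include : HalfEdge B x → HalfEdge A x
    include (e , i , p , q) = e , i , B⊆A e p , q
    position-injective : Injective _≡_ _≡_ (DA.to ∘ include ∘ DB.from)
    position-injective eq = Injection.injective (↔⇒↣ (↔-sym dB))
      (forget-injective (cong forget (Injection.injective (↔⇒↣ dA) eq)))

  -- The cycle already has an edge at the shared vertex, so its degree there is 2, the full degree
  -- of `A`.
  cycle-closed : ∀ (c : CycleOf A) {e e′} → e ∈ edges c → Adjacent A e e′ → e′ ∈ edges c
  cycle-closed c {e} {e′} p (_ , p′ , i , j , q) with two-valent (isCycle c) (end e i)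
  ... | inj₁ d = contradiction (Inverse.to d (e , i , p , refl)) λ ()
  ... | inj₂ d = full-degree (within c) d (degree _) e′ j p′ (sym q)

  cycle-closed-Star : ∀ (c : CycleOf A) {e e′} → e ∈ edges c → Star (Adjacent A) e e′ → e′ ∈ edges c
  cycle-closed-Star c p ε        = p
  cycle-closed-Star c p (r ◅ rs) = cycle-closed-Star c (cycle-closed c p r) rs

  -- Any edge of `c` is reached from `e′` by reversing the given walk to `e` and then moving inside
  -- `c`; this is a walk in `A`, which cannot leave `d`. The other inclusion is symmetric.
  cycles-equal : ∀ (c d : CycleOf A) {e e′} → e ∈ edges c → e′ ∈ edges d →
                 Star (Adjacent A) e e′ → ∀ e″ → edges c e″ ≡ edges d e″
  cycles-equal c d p p′ r e″ = ⇔→≡ (mk⇔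
    (to T-≡ ∘ half c d p p′ r ∘ from T-≡)
    (to T-≡ ∘ half d c p′ p (reverse Adjacent-sym r) ∘ from T-≡))
    where
    open Equivalence using (to; from)
    half : ∀ (c d : CycleOf A) {e e′ e″} → e ∈ edges c → e′ ∈ edges d →
           Star (Adjacent A) e e′ → e″ ∈ edges c → e″ ∈ edges d
    half c d {e} p p′ r p″ = cycle-closed-Star d p′
      (reverse Adjacent-sym r ◅◅
       mapStar (λ (p , q , s) → within c _ p , within c _ q , s) (connected (isCycle c) _ _ p p″))

  edge-at : ∀ x → HalfEdge A x
  edge-at x = Inverse.from (degree x) 0F

  opaque
    -- A vertex takes the colour of the cycle through a chosen edge there. That edge is adjacent to
    -- every edge of `A` at the vertex, so the choice does not matter up to equality of cycles.
    vertexColouring : (S : Func (cycles A) (setoid Bool)) → ∃[ κ ] Represents S κ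
    vertexColouring S = κ , λ c {e} i p →
      let e′ , j , p′ , q = edge-at (end e i)
      in Func.cong S (cycles-equal c (cycleThrough e′ p′) p (∈-cycleThrough p′)
           ((within c e p , p′ , i , j , sym q) ◅ ε))
      where
      κ : Vertex → Bool
      κ x = let e , _ , p , _ = edge-at x in Func.to S (cycleThrough e p)

    cycleColouring : (κ : Vertex → Bool) → (∀ e → e ∈ A → κ (end e 0F) ≡ κ (end e 1F)) →
                     ∃[ S ] Represents S κ
    cycleColouring κ constant =
      record { to = colour
             -- Equal cycles may carry different witness edges; the witness of `d` also lies on `c`,
             -- where `represents` applies.
             ; cong = λ {c} {d} c≈d → sym (represents d 0F
                 (subst T (c≈d _) (proj₂ (nonempty (isCycle c))))) } ,
      represents
      where
      colour : CycleOf A → Bool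
      colour c = κ (end (proj₁ (nonempty (isCycle c))) 0F)
      to-start : ∀ {e} i → e ∈ A → κ (end e i) ≡ κ (end e 0F)
      to-start 0F p = refl
      to-start 1F p = sym (constant _ p)
      along : ∀ (c : CycleOf A) {e e′} → e ∈ edges c → Star (Adjacent (edges c)) e e′ →
              κ (end e 0F) ≡ κ (end e′ 0F)
      along c p ε = refl
      along c p ((_ , p′ , i , j , q) ◅ rs) =
        trans (sym (to-start i (within c _ p)))
          (trans (cong κ q) (trans (to-start j (within c _ p′)) (along c p′ rs)))
      represents : ∀ c {e} i → e ∈ edges c → colour c ≡ κ (end e i)
      represents c i p =
        let _ , p₀ = nonempty (isCycle c)
        in trans (along c p₀ (connected (isCycle c) _ _ p₀ p)) (sym (to-start i (within c _ p)))

-- Cuts of the graph of a map as vertex colourings.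

record Colouring (X : Map) (U : Subset (Map.count X)) : Set where
  open Map X using (Vertex; Edge; end; v; a; _∈_; _∪_; corner; side)
  field
    colour   : Vertex → Bool
    constant : ∀ e → e ∈ v ∪ a → colour (end e 0F) ≡ colour (end e 1F)
    -- The other v-side of the square is side s (next (next i)).
    across   : ∀ s i → side s i ∈ v →
               colour (corner s i) xor colour (corner s (next (next i))) ≡ lookup U s

next⁴ : ∀ i → next (next (next (next i))) ≡ i
next⁴ 0F = refl
next⁴ 1F = refl
next⁴ 2F = refl
next⁴ 3F = refl

≢-cases : ∀ {i j} → i ≢ j → j ≡ next i ⊎ i ≡ next j ⊎ j ≡ next (next i)
≢-cases {0F} {0F} n = contradiction refl n
≢-cases {0F} {1F} _ = inj₁ refl
≢-cases {0F} {2F} _ = inj₂ (inj₂ refl)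
≢-cases {0F} {3F} _ = inj₂ (inj₁ refl)
≢-cases {1F} {0F} _ = inj₂ (inj₁ refl)
≢-cases {1F} {1F} n = contradiction refl n
≢-cases {1F} {2F} _ = inj₁ refl
≢-cases {1F} {3F} _ = inj₂ (inj₂ refl)
≢-cases {2F} {0F} _ = inj₂ (inj₂ refl)
≢-cases {2F} {1F} _ = inj₂ (inj₁ refl)
≢-cases {2F} {2F} n = contradiction refl n
≢-cases {2F} {3F} _ = inj₁ refl
≢-cases {3F} {0F} _ = inj₁ refl
≢-cases {3F} {1F} _ = inj₂ (inj₂ refl)
≢-cases {3F} {2F} _ = inj₂ (inj₁ refl)
≢-cases {3F} {3F} n = contradiction refl n

xor-true : ∀ x y → x xor y ≡ true → (x ≡ true × y ≡ false) ⊎ (x ≡ false × y ≡ true)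
xor-true true  false _ = inj₁ (refl , refl)
xor-true false true  _ = inj₂ (refl , refl)

xor-exchange : ∀ w x y z → w xor x ≡ y xor z → w xor y ≡ x xor z
xor-exchange true  true  true  true  _ = refl
xor-exchange true  true  false false _ = refl
xor-exchange true  false true  false _ = refl
xor-exchange true  false false true  _ = refl
xor-exchange false true  true  false _ = refl
xor-exchange false true  false true  _ = refl
xor-exchange false false true  true  _ = refl
xor-exchange false false false false _ = refl

xor-cancelˡ : ∀ w x y → (w xor x) xor (w xor y) ≡ x xor y
xor-cancelˡ true  x y = xor-annihilates-not x y
xor-cancelˡ false x y = refl

module Cuts (X : Map) where
  open Map X hiding (_⊆_)
  open Phial X using (v⊎f; v-next; f-next; not-both; source; i≢next²)
  open CycleOf

  opaque
    -- By disjointness of `v` and `f`, `v ∪ a` is the complement of `f`. The phial construction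
    -- gives the degree of the complement of `v`; it is applied to the dual, whose `v` is `f`.
    v∪a-degree : ∀ x → HasDegree (v ∪ a) x 2
    v∪a-degree x = Phial.∁v-degree (dual X) x ↔-∘
                   HalfEdge-cong C (λ e _ _ → to e) (λ e _ _ → from e)
      where
      to : ∀ e → e ∈ v ∪ a → e ∈ ∁ f
      to e p with v e | f e | v-f e
      ... | true  | true  | d = d tt tt
      ... | true  | false | _ = tt
      ... | false | true  | _ = p
      ... | false | false | _ = tt
      from : ∀ e → e ∈ ∁ f → e ∈ v ∪ a
      from e p with v e | f e
      ... | true  | _     = tt
      ... | false | false = tt

  open TwoRegular C (v ∪ a) v∪a-degree

  v⇒v∪a : ∀ {e} → e ∈ v → e ∈ v ∪ a
  v⇒v∪a p = Equivalence.from T-∨ (inj₁ p)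

  v-opposite : ∀ s i → side s i ∈ v → side s (next (next i)) ∈ v
  v-opposite s i p = f-next s (next i) (v-next s i p)

  -- Consecutive sides share a corner and cannot both lie in the matching `v`, so distinct `v`-sides
  -- of a square are opposite.
  opposite-unique : ∀ {s i j} → side s i ∈ v → side s j ∈ v → i ≢ j → j ≡ next (next i)
  opposite-unique {s} {i} {j} p q n with ≢-cases n
  ... | inj₁ refl        = contradiction q (not-both v-matching s i p)
  ... | inj₂ (inj₁ refl) = contradiction p (not-both v-matching s j q)
  ... | inj₂ (inj₂ eq)   = eq

  v-side : ∀ s → ∃[ i ] side s i ∈ v
  v-side s with v⊎f s 0F
  ... | inj₁ p = 0F , p
  ... | inj₂ p = 1F , f-next s 0F p

  Represents-corner : ∀ S κ → Represents S κ → ∀ {s i} c → side s i ∈ edges c →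
                      Func.to S c ≡ κ (corner s i)
  Represents-corner S κ r {s} {i} c p =
    let k , eq = source (joins s i) in trans (r c k p) (cong κ eq)

  -- A cut names its two cycles in order, `true` first, whereas `xor` is symmetric. Both directions
  -- of `across` therefore split on which of the two `v`-sides is coloured `true`.
  coboundary⇒colouring : ∀ {U} → Coboundary (G X) U → Colouring X U
  coboundary⇒colouring {U} (S , cut) = record
    { colour   = κ
    ; constant = λ e p → trans (sym (rep (cycleThrough e p) 0F (∈-cycleThrough p)))
                               (rep (cycleThrough e p) 1F (∈-cycleThrough p))
    ; across   = across
    }
    where
    κ = proj₁ (vertexColouring S)
    rep = proj₂ (vertexColouring S)
    cut-value : ∀ {s i j} → side s i ∈ v → side s j ∈ v → i ≢ j →
                κ (corner s i) ≡ true → κ (corner s j) ≡ false → lookup U s ≡ true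
    cut-value {s} p q n t f = []=⇒lookup (Equivalence.from (cut s)
      (c , d , (_ , _ , n , p , ∈-cycleThrough _ , q , ∈-cycleThrough _) ,
       trans (Represents-corner S κ rep c (∈-cycleThrough _)) t ,
       trans (Represents-corner S κ rep d (∈-cycleThrough _)) f))
      where
      c = cycleThrough _ (v⇒v∪a p)
      d = cycleThrough _ (v⇒v∪a q)
    opposite-colours : ∀ {s i} → side s i ∈ v → lookup U s ≡ true →
                       κ (corner s i) xor κ (corner s (next (next i))) ≡ true
    opposite-colours {s} {i} p u with Equivalence.to (cut s) (lookup⇒[]= s U u)
    ... | c , d , (k , l , n , pk , kc , pl , ld) , t , f with i ≟ k
    ...   | yes refl with opposite-unique pk pl n
    ...     | refl = cong₂ _xor_ (trans (sym (Represents-corner S κ rep c kc)) t)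
                                 (trans (sym (Represents-corner S κ rep d ld)) f)
    opposite-colours {s} {i} p u | c , d , (k , l , n , pk , kc , pl , ld) , t , f | no i≢k
      with opposite-unique p pk i≢k
    -- Here `k` is opposite `i` and `l` is opposite `k`, so `l` is `i` again.
    ... | refl with trans (opposite-unique pk pl n) (next⁴ i)
    ...   | refl = cong₂ _xor_ (trans (sym (Represents-corner S κ rep d ld)) f)
                               (trans (sym (Represents-corner S κ rep c kc)) t)
    across : ∀ s i → side s i ∈ v →
             κ (corner s i) xor κ (corner s (next (next i))) ≡ lookup U s
    across s i p = ⇔→≡ {z = true} (mk⇔ forth (opposite-colours p))
      where
      forth : κ (corner s i) xor κ (corner s (next (next i))) ≡ true → lookup U s ≡ true
      forth eq with xor-true (κ (corner s i)) _ eq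
      ... | inj₁ (t , f) = cut-value p (v-opposite s i p) (i≢next² i) t f
      ... | inj₂ (f , t) = cut-value (v-opposite s i p) p (i≢next² i ∘ sym) t f

  colouring⇒coboundary : ∀ {U} → Colouring X U → Coboundary (G X) U
  colouring⇒coboundary {U} κ = S , λ s → mk⇔ (forth s) (back s)
    where
    open Colouring κ
    S = proj₁ (cycleColouring colour constant)
    rep = proj₂ (cycleColouring colour constant)
    Cut : Square → Set
    Cut s = ∃[ c ] ∃[ d ] SetoidGraph.Joins (G X) s c d × Func.to S c ≡ true × Func.to S d ≡ false
    cut : ∀ {s i j} → side s i ∈ v → side s j ∈ v → i ≢ j →
          colour (corner s i) ≡ true → colour (corner s j) ≡ false → Cut s
    cut {s} p q n t f =
      c , d , (_ , _ , n , p , ∈-cycleThrough _ , q , ∈-cycleThrough _) ,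
      trans (Represents-corner S colour rep c (∈-cycleThrough _)) t ,
      trans (Represents-corner S colour rep d (∈-cycleThrough _)) f
      where
      c = cycleThrough _ (v⇒v∪a p)
      d = cycleThrough _ (v⇒v∪a q)
    forth : ∀ s → s Subset.∈ U → Cut s
    -- `across` speaks only of positions that hold a `v`-side, so one must be located first.
    forth s s∈U with v-side s
    ... | i , p with xor-true (colour (corner s i)) _ (trans (across s i p) ([]=⇒lookup s∈U))
    ...   | inj₁ (t , f) = cut p (v-opposite s i p) (i≢next² i) t f
    ...   | inj₂ (f , t) = cut (v-opposite s i p) p (i≢next² i ∘ sym) t f
    back : ∀ s → Cut s → s Subset.∈ U
    back s (c , d , (i , j , n , p , ic , q , jd) , t , f) with opposite-unique p q n
    ... | refl = lookup⇒[]= s U (trans (sym (across s i p))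
      (cong₂ _xor_ (trans (sym (Represents-corner S colour rep c ic)) t)
                   (trans (sym (Represents-corner S colour rep d jd)) f)))

-- Colours along the sides and diagonals of a square.

module _ (X : Map) {U} (κ : Colouring X U) where
  open Map X hiding (_⊆_)
  open Colouring κ
  open Phial X using (v⊎f; f-next)
  open Cuts X using (v⇒v∪a; v-opposite)

  along-v : ∀ s i → side s i ∈ v → colour (corner s i) ≡ colour (corner s (next i))
  along-v s i p with joins s i
  ... | inj₁ (q , r) = trans (cong colour (sym q)) (trans (constant _ (v⇒v∪a p)) (cong colour r))
  ... | inj₂ (q , r) = trans (cong colour (sym r)) (trans (sym (constant _ (v⇒v∪a p))) (cong colour q))

  -- If side `i` is in `f`, the two neighbouring sides are in `v` and each has constant colour. They
  -- carry the colours of this diagonal, in reversed order, to the other diagonal, where `across`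
  -- applies.
  diagonal : ∀ s i → colour (corner s i) xor colour (corner s (next (next i))) ≡ lookup U s
  diagonal s i with v⊎f s i
  ... | inj₁ p = across s i p
  ... | inj₂ p = trans (xor-comm (colour (corner s i)) _) (trans (cong₂ _xor_
      (sym (along-v s (next i) q))
      (sym (trans (along-v s _ (v-opposite s (next i) q)) (cong (colour ∘ corner s) (next⁴ i)))))
      (across s (next i) q))
    where q = f-next s i p

-- The sum colouring on the phial.

module _ (M : Map) {U} (κ₁ : Colouring M U) (κ₂ : Colouring (dual M) U) where
  open Map M hiding (_⊆_)
  open Phial M
  private
    module κ₁ = Colouring κ₁
    module κ₂ = Colouring κ₂

  sum : Vertex → Bool
  sum x = κ₁.colour x xor κ₂.colour x

  sum-along-diagonal : ∀ s i → sum (corner s i) ≡ sum (corner s (next (next i)))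
  sum-along-diagonal s i = xor-exchange (κ₁.colour (corner s i)) _ (κ₂.colour (corner s i)) _
    (trans (diagonal M κ₁ s i) (sym (diagonal (dual M) κ₂ s i)))

  -- `κ₁` is constant along the `v`-side and cancels. `κ₂` is constant along the next side, which is
  -- in `f`, so its change along the `v`-side equals its change along the diagonal.
  sum-across-v : ∀ s i → side s i ∈ v → sum (corner s i) xor sum (corner s (next i)) ≡ lookup U s
  sum-across-v s i p rewrite along-v M κ₁ s i p =
    trans (xor-cancelˡ (κ₁.colour (corner s (next i))) _ _)
      (trans (cong (κ₂.colour (corner s i) xor_) (along-v (dual M) κ₂ s (next i) (v-next s i p)))
        (diagonal (dual M) κ₂ s i))

  phialColouring : Colouring (phial M) U
  phialColouring = record { colour = sum ; constant = constant
                          ; across = λ s → across s (alternation s) }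
    where
    a-constant : ∀ e → e ∈ ∁ v → e ∈ ∁ f → sum (end e 0F) ≡ sum (end e 1F)
    a-constant e p q = cong₂ _xor_ (κ₁.constant e in₁) (κ₂.constant e in₂)
      where
      in₁ : e ∈ v ∪ a
      in₁ with v e | f e
      ... | true  | _     = tt
      ... | false | false = tt
      in₂ : T (f e ∨ not (f e ∨ v e))
      in₂ with v e | f e
      ... | _     | true  = tt
      ... | false | false = tt
    constant : ∀ e → e P.∈ Map.v (phial M) P.∪ Map.a (phial M) → sum (P.end e 0F) ≡ sum (P.end e 1F)
    -- By computation `t` says that `e` avoids `v` and `p` that it avoids `f`: the `a`-edges of the
    -- phial that come from `C` are those of `M`.
    constant (inj₁ e , t) p = a-constant e t p
    constant (inj₂ (s , 0F) , _) _ = sum-along-diagonal s 0F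
    constant (inj₂ (s , 1F) , _) _ = sum-along-diagonal s 1F
    across : ∀ s α i → sideP s α i P.∈ zP →
             sum (corner s (perm α i)) xor sum (corner s (perm α (next (next i)))) ≡ lookup U s
    -- The diagonals sit at positions 0 and 2 of the phial square. After `perm`, the corners at
    -- these positions are joined by a `v`-side of the original square: side 0 for `f-odd`, side 3
    -- for `f-even`.
    across s (f-odd  _ _ v0 _) 0F _ = sum-across-v s 0F v0
    across s (f-odd  _ _ v0 _) 2F _ = trans (xor-comm (sum (corner s 1F)) _) (sum-across-v s 0F v0)
    across s (f-even _ _ _ v3) 0F _ = trans (xor-comm (sum (corner s 0F)) _) (sum-across-v s 3F v3)
    across s (f-even _ _ _ v3) 2F _ = sum-across-v s 3F v3
    across s (f-odd  _ _ _ _) 3F ()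
    across s (f-even _ _ _ _) 3F ()

theorem2p5 : (M : Map) → V M ∩ F M ⊆ Z M
theorem2p5 M (V-cut , F-cut) = Cuts.colouring⇒coboundary (phial M)
  (phialColouring M (Cuts.coboundary⇒colouring M V-cut)
                    (Cuts.coboundary⇒colouring (dual M) F-cut))
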